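{- Let $k\ge 5$ be a natural number. The greedy algorithm $\textsc{gr}$ for the problem GEP-DW has a linear lower bound on its competitive ratio both on ladders and on square grids. That is, for each of the two families of grids $H_n = G_{2,n}$ and $H_n = G_{n,n}$ there exist a constant $a>0$ and infinitely many $n$ for which there is an instance $I$ of GEP-DW with underlying undirected graph $H_n$, start vertex $s_0=(1,1)$ and all arc weights in $\{1,k\}$, such that $$\frac{\mathrm{cost}_{\textsc{gr}}(I)}{\mathrm{cost}_{\textsc{opt}}(I)} \ \ge\ \frac{n}{a}.$$
   Context: For $m,n\ge 1$, the undirected $m\times n$ grid $G_{m,n}=(V,E)$ has $V=\{(i,j) : 1\le i\le m,\ 1\le j\le n\}$ and edges $\{(i,j),(i+1,j)\}$ for $1\le i\le m-1$, $1\le j\le n$, and $\{(i,j),(i,j+1)\}$ for $1\le i\le m$, $1\le j\le n-1$. Ladders are the grids $G_{2,n}$; square grids are the grids $G_{n,n}$. GEP-DW (graph exploration problem in a directed graph with known graph structure and unknown edge weights and orientations): an instance consists of an undirected graph, a start vertex $s_0$, an orientation of the graph (for every edge $\{u,v\}$ exactly one of the arcs $(u,v)$, $(v,u)$ is present), and a weight for every arc, such that there is a directed path starting in $s_0$ (vertices and arcs may be repeated) that visits all vertices. An agent starts in $s_0$ and must travel along a directed path visiting every vertex at least once (it may end anywhere), minimizing the sum of the weights of the traversed arcs, counted with multiplicity. The agent knows the underlying undirected graph from the beginning, but not the orientations and weights. When it first visits a vertex (in particular $s_0$ at the beginning), the orientations of the edges incident to that vertex and the weights of the arcs going out from that vertex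 are revealed. The agent remembers everything revealed. The greedy algorithm $\textsc{gr}$ repeatedly moves the agent along a cheapest path (with respect to the currently known arcs and weights, i.e. using arcs going out from visited vertices) from its current vertex to some not yet visited vertex, until all vertices are visited; ties are broken by an arbitrary fixed deterministic rule. $\mathrm{cost}_{\textsc{gr}}(I)$ is the cost of the path traveled by $\textsc{gr}$ on $I$, and $\mathrm{cost}_{\textsc{opt}}(I)$ is the minimum cost of a directed path in $I$ starting in $s_0$ that visits all vertices. -}

module Defs where

open import Data.Bool using (T; _xor_; if_then_else_)
open import Data.Fin using (Fin; zero; toℕ)
import Data.Fin.Properties as Fin
open import Data.Integer using (+_)
open import Data.List using (List; []; _∷_; [_]; allFin; cartesianProduct)
open import Data.List.Membership.Propositional using (_∈_; _∉_)
open import Data.List.Membership.Propositional.Properties using (∈-cartesianProduct⁺; ∈-allFin)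
import Data.List.Membership.DecPropositional as DecMembership
open import Data.Maybe using (Maybe; just; nothing; is-just)
open import Data.Nat using (ℕ; suc; _+_; _≤_; NonZero)
import Data.Nat.Properties as ℕ
open import Data.Product using (Σ-syntax; ∃; ∃-syntax; _×_; _,_; proj₁; proj₂)
open import Data.Product.Properties using (≡-dec)
open import Data.Rational.Unnormalised as ℚᵘ using (ℚᵘ; _/_; _÷_)
import Data.Rational.Unnormalised.Properties as ℚᵘ
open import Data.Sum using (_⊎_; inj₁; inj₂)
open import Relation.Binary.Construct.Closure.ReflexiveTransitive as Star using (Star; ε; _◅_; _◅◅_)
open import Relation.Binary.Construct.Closure.Symmetric using (SymClosure; fwd; bwd; symmetric)
open import Relation.Binary.Definitions using (Decidable; DecidableEquality; Symmetric)
open import Relation.Binary.PropositionalEquality using (_≡_)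
open import Relation.Nullary using (¬_; yes; no; does)
open import Relation.Nullary.Decidable using (_×-dec_; _⊎-dec_; map′)

------------------------------------------------------------------------
-- Finite simple undirected graphs and grids

record Graph : Set₁ where
  infix 4 _~_ _≟_ _~?_
  field
    Vertex     : Set
    _~_        : Vertex → Vertex → Set
    ~-sym      : Symmetric _~_
    ~-irrefl   : ∀ {v} → ¬ (v ~ v)
    _≟_        : DecidableEquality Vertex
    _~?_       : Decidable _~_
    vertices   : List Vertex
    ∈-vertices : ∀ v → v ∈ vertices

open Graph using (Vertex)

-- Coordinates are 0-based: (i , j) stands for the vertex (i + 1, j + 1).
GridStep : ∀ {m n} → Fin m × Fin n → Fin m × Fin n → Set
GridStep (i , j) (i′ , j′) =
  (suc (toℕ i) ≡ toℕ i′ × j ≡ j′) ⊎ (i ≡ i′ × suc (toℕ j) ≡ toℕ j′)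

gridStep? : ∀ {m n} → Decidable (GridStep {m} {n})
gridStep? (i , j) (i′ , j′) =
  (suc (toℕ i) ℕ.≟ toℕ i′ ×-dec j Fin.≟ j′)
    ⊎-dec (i Fin.≟ i′ ×-dec suc (toℕ j) ℕ.≟ toℕ j′)

gridStep-irrefl : ∀ {m n} {v : Fin m × Fin n} → ¬ GridStep v v
gridStep-irrefl (inj₁ (eq , _)) = ℕ.1+n≢n eq
gridStep-irrefl (inj₂ (_ , eq)) = ℕ.1+n≢n eq

grid : ℕ → ℕ → Graph
grid m n = record
  { Vertex     = Fin m × Fin n
  ; _~_        = SymClosure GridStep
  ; ~-sym      = symmetric GridStep
  ; ~-irrefl   = λ { (fwd s) → gridStep-irrefl s ; (bwd s) → gridStep-irrefl s }
  ; _≟_        = ≡-dec Fin._≟_ Fin._≟_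
  ; _~?_       = λ u v → map′ (λ { (inj₁ s) → fwd s ; (inj₂ s) → bwd s })
                              (λ { (fwd s) → inj₁ s ; (bwd s) → inj₂ s })
                              (gridStep? u v ⊎-dec gridStep? v u)
  ; vertices   = cartesianProduct (allFin m) (allFin n)
  ; ∈-vertices = λ { (i , j) → ∈-cartesianProduct⁺ (∈-allFin i) (∈-allFin j) }
  }

corner : ∀ m n → .{{_ : NonZero m}} → .{{_ : NonZero n}} → Vertex (grid m n)
corner (suc _) (suc _) = zero , zero

------------------------------------------------------------------------
-- Weighted arcs and directed walks

-- A u v ≡ just w means that the arc (u , v) is present with weight w;
-- A u v ≡ nothing means that it is absent.
Arcs : Set → Set
Arcs V = V → V → Maybe ℕ

module _ {V : Set} where

  Arc : Arcs V → V → V → Set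
  Arc A u v = ∃[ w ] A u v ≡ just w

  -- Vertices and arcs may be repeated.
  Walk : Arcs V → V → V → Set
  Walk A = Star (Arc A)

  cost : ∀ {A u v} → Walk A u v → ℕ
  cost ε             = 0
  cost ((w , _) ◅ p) = w + cost p

  trail : ∀ {A u v} → Walk A u v → List V
  trail {u = u} ε       = [ u ]
  trail {u = u} (_ ◅ p) = u ∷ trail p

  VisitsAll : ∀ {A u v} → Walk A u v → Set
  VisitsAll p = ∀ x → x ∈ trail p

------------------------------------------------------------------------
-- Instances of GEP-DW

record Instance (G : Graph) : Set where
  open Graph G using (_~_)
  field
    start    : Vertex G
    arc      : Arcs (Vertex G)
    arc⇒edge : ∀ {u v} → Arc arc u v → u ~ v
    oriented : ∀ {u v} → u ~ v → T (is-just (arc u v) xor is-just (arc v u))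
    solvable : ∃[ t ] Σ[ p ∈ Walk arc start t ] VisitsAll p

open Instance

-- The information of the agent.  For a visited vertex u and a neighbour v
-- of u, known u v ≡ nothing also tells the agent that the edge between
-- them is oriented as (v , u), since exactly one of the arcs is present.
record Knowledge (G : Graph) : Set where
  field
    travelled : List (Vertex G)
    position  : Vertex G
    known     : Arcs (Vertex G)

open Knowledge

module _ {G : Graph} (I : Instance G) where

  open DecMembership (Graph._≟_ G) using (_∈?_)

  revealed : List (Vertex G) → Arcs (Vertex G)
  revealed visited u v = if does (u ∈? visited) then arc I u v else nothing

  revealed⇒arc : ∀ visited {u v} → Arc (revealed visited) u v → Arc (arc I) u v
  revealed⇒arc visited {u} (w , eq) with u ∈? visited
  ... | yes _ = w , eq
  revealed⇒arc visited {u} (w , ()) | no _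

  observe : ∀ {u} → Walk (arc I) (start I) u → Knowledge G
  observe {u} p = record
    { travelled = trail p
    ; position  = u
    ; known     = revealed (trail p)
    }

------------------------------------------------------------------------
-- The greedy algorithm

Move : ∀ {G} → Knowledge G → Set
Move K = ∃[ t ] Walk (known K) (position K) t

Exploring : ∀ {G} (K : Knowledge G) → Move K → Set
Exploring K (t , _) = t ∉ travelled K

CheapestExploring : ∀ {G} (K : Knowledge G) → Move K → Set
CheapestExploring K M =
  Exploring K M × (∀ M′ → Exploring K M′ → cost (proj₂ M) ≤ cost (proj₂ M′))

-- A deterministic tie-breaking rule amounts to a function choosing, in
-- every state of information, one of the cheapest paths to an unvisited
-- vertex.  The value of the function is irrelevant if there is no such path.
record Greedy : Set₁ where
  field
    move     : ∀ G (K : Knowledge G) → Move K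
    cheapest : ∀ {G} (K : Knowledge G) →
               ∃ (Exploring K) → CheapestExploring K (move G K)

open Greedy

module _ {G : Graph} (gr : Greedy) (I : Instance G) where

  extend : ∀ {u} (p : Walk (arc I) (start I) u) (M : Move (observe I p)) →
           Walk (arc I) (start I) (proj₁ M)
  extend p (_ , q) = p ◅◅ Star.map (revealed⇒arc I (trail p)) q

  -- The walks travelled by the greedy algorithm after some number of rounds.
  data GreedyWalk : ∀ {u} → Walk (arc I) (start I) u → Set where
    begin : GreedyWalk ε
    round : ∀ {u} {p : Walk (arc I) (start I) u} →
            GreedyWalk p →
            Exploring (observe I p) (move gr G (observe I p)) →
            GreedyWalk (extend p (move gr G (observe I p)))

  -- A greedy run may get stuck in general; it has a cost only if it
  -- explores the whole graph.
  CostGR : ℕ → Set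
  CostGR c = ∃[ t ] Σ[ p ∈ Walk (arc I) (start I) t ]
    GreedyWalk p × VisitsAll p × cost p ≡ c

module _ {G : Graph} (I : Instance G) where

  CostOPT : ℕ → Set
  CostOPT c =
    (∃[ t ] Σ[ p ∈ Walk (arc I) (start I) t ] VisitsAll p × cost p ≡ c)
    × (∀ {t} (p : Walk (arc I) (start I) t) → VisitsAll p → c ≤ cost p)

  WeightsOneOr : ℕ → Set
  WeightsOneOr k = ∀ {u v w} → arc I u v ≡ just w → w ≡ 1 ⊎ w ≡ k

------------------------------------------------------------------------
-- Linear lower bounds on families of rooted graphs indexed by n ≥ 1

RatioAtLeast : ∀ {G} → Greedy → Instance G → ℚᵘ → Set
RatioAtLeast gr I r =
  ∃[ cgr ] ∃[ copt ] CostGR gr I cgr × CostOPT I copt ×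
    Σ[ nz ∈ NonZero copt ] r ℚᵘ.≤ ((+ cgr) / copt) {{nz}}

LinearLowerBound : (k : ℕ) → Greedy →
                   (H : ∀ n → .{{NonZero n}} → Graph) →
                   (∀ n → .{{_ : NonZero n}} → Vertex (H n)) → Set
LinearLowerBound k gr H s₀ =
  Σ[ a ∈ ℚᵘ ] Σ[ a>0 ∈ ℚᵘ.Positive a ]
    ∀ N → Σ[ n ∈ ℕ ] Σ[ nz ∈ NonZero n ] N ≤ n ×
      Σ[ I ∈ Instance (H n {{nz}}) ]
        start I ≡ s₀ n {{nz}} ×
        WeightsOneOr I k ×
        RatioAtLeast gr I (((+ n) / 1 ÷ a) {{ℚᵘ.pos⇒nonZero a {{a>0}}}})

{-# OPTIONS --safe #-}

-- A 2m × n grid is oriented as a stack of m ladders.  The upper (back) row of a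
-- ladder is directed towards its column 0 at cost 1, the lower (forth) row away
-- from it at cost k.  In column 0 the rung leads down, in all other columns up,
-- always at cost 1.  The last vertex of the forth row leads at cost k to the
-- column 0 of the next ladder, which is mirrored; all other edges between
-- consecutive ladders lead up.  Having entered a column, the agent prefers the
-- rung at cost 1 to the next column at cost k.  From there the only arc leading
-- to an unvisited vertex starts on the forth row, so the agent has to go back to
-- column 0 and forth again: exploring a ladder costs Ω(n²).  A tour that
-- runs through the forth row first costs O(kn) per ladder.  The case m = 1 gives
-- ladders, the case n = 2m square grids.

module Submission where

open import Defs hiding (begin)
open import Data.Bool using (Bool; true; false; not; T; _xor_)
open import Data.Fin using (Fin; toℕ; fromℕ<)
import Data.Fin.Properties as Fin
open import Data.List using (List; []; _∷_)
open import Data.List.Membership.Propositional using (_∈_; _∉_)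
open import Data.List.Relation.Binary.Subset.Propositional using (_⊆_)
import Data.List.Membership.DecPropositional as DecMembership
open import Data.List.Relation.Unary.All as All using ()
open import Data.List.Relation.Unary.Any as Any using (here; there)
import Data.Integer as ℤ
import Data.Integer.Properties as ℤ
open import Data.Maybe using (just; nothing; is-just)
open import Data.Nat using (ℕ; zero; suc; _+_; _*_; _∸_; _≤_; _<_; z≤n; s≤s; s≤s⁻¹; _≤?_; _≟_; NonZero; >-nonZero)
open import Data.Nat.Induction using (<-rec)
open import Data.Nat.Properties
open import Data.Nat.Tactic.RingSolver using (solve-∀)
open import Data.Product using (Σ-syntax; ∃; ∃-syntax; _×_; _,_; proj₁; proj₂)
open import Data.Rational.Unnormalised as ℚᵘ using (*≤*; _/_; _÷_)
open import Data.Sum as Sum using (_⊎_; inj₁; inj₂)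
open import Relation.Binary.Construct.Closure.ReflexiveTransitive as Star using (ε; _◅_; _◅◅_)
open import Relation.Binary.Construct.Closure.Symmetric using (fwd; bwd)
open import Relation.Binary.PropositionalEquality using (_≡_; _≢_; refl; sym; trans; cong; cong₂; subst; module ≡-Reasoning)
open import Relation.Nullary using (¬_; Dec; yes; no; contradiction)
open import Relation.Nullary.Decidable using (map′)

open Graph using (Vertex)
open Instance

-- Walks

module _ {V : Set} {A : Arcs V} where

  start∈trail : ∀ {u v} (p : Walk A u v) → u ∈ trail p
  start∈trail ε       = here refl
  start∈trail (_ ◅ _) = here refl

  end∈trail : ∀ {u v} (p : Walk A u v) → v ∈ trail p
  end∈trail ε       = here refl
  end∈trail (_ ◅ p) = there (end∈trail p)

  ∈-trail-◅◅⁺ˡ : ∀ {u v w x} (p : Walk A u v) (q : Walk A v w) →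
                 x ∈ trail p → x ∈ trail (p ◅◅ q)
  ∈-trail-◅◅⁺ˡ ε       q (here refl) = start∈trail q
  ∈-trail-◅◅⁺ˡ (_ ◅ p) q (here refl) = here refl
  ∈-trail-◅◅⁺ˡ (_ ◅ p) q (there x∈p) = there (∈-trail-◅◅⁺ˡ p q x∈p)

  ∈-trail-◅◅⁺ʳ : ∀ {u v w x} (p : Walk A u v) (q : Walk A v w) →
                 x ∈ trail q → x ∈ trail (p ◅◅ q)
  ∈-trail-◅◅⁺ʳ ε       q x∈q = x∈q
  ∈-trail-◅◅⁺ʳ (_ ◅ p) q x∈q = there (∈-trail-◅◅⁺ʳ p q x∈q)

  ∈-trail-◅◅⁻ : ∀ {u v w x} (p : Walk A u v) (q : Walk A v w) →
                x ∈ trail (p ◅◅ q) → x ∈ trail p ⊎ x ∈ trail q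
  ∈-trail-◅◅⁻ ε       q x∈         = inj₂ x∈
  ∈-trail-◅◅⁻ (_ ◅ p) q (here eq)  = inj₁ (here eq)
  ∈-trail-◅◅⁻ (_ ◅ p) q (there x∈) with ∈-trail-◅◅⁻ p q x∈
  ... | inj₁ x∈p = inj₁ (there x∈p)
  ... | inj₂ x∈q = inj₂ x∈q

  cost-◅◅ : ∀ {u v w} (p : Walk A u v) (q : Walk A v w) →
            cost (p ◅◅ q) ≡ cost p + cost q
  cost-◅◅ ε             q = refl
  cost-◅◅ ((w , _) ◅ p) q = trans (cong (w +_) (cost-◅◅ p q)) (sym (+-assoc w _ _))

Positive : ∀ {V} → Arcs V → Set
Positive A = ∀ {u v w} → A u v ≡ just w → 1 ≤ w

-- Cheapest covering walks

least : ∀ {P : ℕ → Set} → (∀ n → Dec (P n)) → ∀ n → P n →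
        ∃[ m ] P m × m ≤ n × (∀ i → P i → m ≤ i)
least {P} P? = <-rec _ search
  where
  search : ∀ n → (∀ {j} → j < n → P j → ∃[ m ] P m × m ≤ j × (∀ i → P i → m ≤ i)) →
           P n → ∃[ m ] P m × m ≤ n × (∀ i → P i → m ≤ i)
  search n rec pn with anyUpTo? P? n
  ... | yes (j , j<n , pj) with rec j<n pj
  ...   | m , pm , m≤j , min = m , pm , ≤-trans m≤j (<⇒≤ j<n) , min
  search n rec pn | no none = n , pn , ≤-refl , λ i pi → ≮⇒≥ λ i<n → none (i , i<n , pi)

module _ {X : Set} {x y : X} {xs ys : List X} where

  move⁺ : x ∈ y ∷ xs ⊎ x ∈ ys → x ∈ xs ⊎ x ∈ y ∷ ys
  move⁺ (inj₁ (here eq))  = inj₂ (here eq)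
  move⁺ (inj₁ (there x∈)) = inj₁ x∈
  move⁺ (inj₂ x∈)         = inj₂ (there x∈)

  move⁻ : x ∈ xs ⊎ x ∈ y ∷ ys → x ∈ y ∷ xs ⊎ x ∈ ys
  move⁻ (inj₁ x∈)         = inj₁ (there x∈)
  move⁻ (inj₂ (here eq))  = inj₁ (here eq)
  move⁻ (inj₂ (there x∈)) = inj₂ x∈

module _ {G : Graph} {A : Arcs (Vertex G)} (positive : Positive A) where

  open DecMembership (Graph._≟_ G) using (_∈?_)

  -- The list `visited` stands for the vertices passed before `u`, so that covering can be decided
  -- arc by arc: cutting off the first arc puts its source on the list.
  CoveringWalk : List (Vertex G) → Vertex G → ℕ → Set
  CoveringWalk visited u c =
    ∃[ t ] Σ[ p ∈ Walk A u t ] (∀ x → x ∈ visited ⊎ x ∈ trail p) × cost p ≡ c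

  ∀-vertices? : ∀ {P : Vertex G → Set} → (∀ v → Dec (P v)) → Dec (∀ v → P v)
  ∀-vertices? P? = map′ (λ ps v → All.lookup ps (Graph.∈-vertices G v))
                        (λ ps → All.tabulate (λ {v} _ → ps v))
                        (All.all? P? (Graph.vertices G))

  ∃-vertices? : ∀ {P : Vertex G → Set} → (∀ v → Dec (P v)) → Dec (∃ P)
  ∃-vertices? P? = map′ Any.satisfied
                        (λ (v , pv) → Any.map (λ eq → subst _ eq pv) (Graph.∈-vertices G v))
                        (Any.any? P? (Graph.vertices G))

  FirstStep : List (Vertex G) → Vertex G → ℕ → Vertex G → Set
  FirstStep visited u c v =
    ∃[ w ] A u v ≡ just w × w ≤ c × CoveringWalk (u ∷ visited) v (c ∸ w)

  -- The fuel bounds the cost and hence, the weights being positive, the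
  -- length of the walks to be searched.
  coveringWalk? : ∀ fuel visited u c → c ≤ fuel → Dec (CoveringWalk visited u c)
  firstStep? : ∀ fuel visited u c v → c ≤ fuel → Dec (FirstStep visited u c v)

  coveringWalk? fuel visited u c c≤ with c ≟ 0 | ∀-vertices? (_∈? (u ∷ visited))
  ... | yes refl | yes all = yes (u , ε , (λ x → move⁺ (inj₁ (all x))) , refl)
  ... | yes refl | no ¬all = no λ where
    (_ , ε , all , _) → ¬all λ x → Sum.fromInj₁ (λ ()) (move⁻ (all x))
    (_ , (w , eq) ◅ p , _ , c≡) →
      contradiction (positive eq) (<⇒≱ (≤-<-trans (m≤m+n w _) (s≤s (≤-reflexive c≡))))
  ... | no c≢0 | _ = map′ prepend split (∃-vertices? λ v → firstStep? fuel visited u c v c≤)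
    where
    prepend : ∃ (FirstStep visited u c) → CoveringWalk visited u c
    prepend (v , w , eq , w≤c , t , p , all , c≡) =
      t , (w , eq) ◅ p , (λ x → move⁺ (all x)) , trans (cong (w +_) c≡) (m+[n∸m]≡n w≤c)
    split : CoveringWalk visited u c → ∃ (FirstStep visited u c)
    split (_ , ε , _ , c≡) = contradiction (sym c≡) c≢0
    split (t , _◅_ {j = v} (w , eq) p , all , refl) =
      v , w , eq , m≤m+n w _ , t , p , (λ x → move⁻ (all x)) , sym (m+n∸m≡n w _)

  firstStep? fuel visited u c v c≤ with A u v in eq
  ... | nothing = no λ ()
  firstStep? zero visited u c v c≤ | just w =
    no λ { (_ , refl , w≤c , _) → contradiction (positive eq) (<⇒≱ (s≤s (≤-trans w≤c c≤))) }
  firstStep? (suc fuel) visited u c v c≤ | just w with w ≤? c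
  ... | no w≰c = no λ { (_ , refl , w≤c , _) → w≰c w≤c }
  ... | yes w≤c = map′ (λ walk → w , refl , w≤c , walk) (λ { (_ , refl , _ , walk) → walk })
    (coveringWalk? fuel (u ∷ visited) v (c ∸ w)
      (≤-trans (∸-monoʳ-≤ c (positive eq)) (∸-monoˡ-≤ 1 c≤)))

module _ {G : Graph} (I : Instance G) (positive : Positive (arc I)) where

  abstract

    -- `CostOPT` asks for an attained minimum, to be found constructively. Covering walks of a given
    -- cost are decidable, and `cost p` starts the descent to the least such cost.
    costOPT≤ : ∀ {t} (p : Walk (arc I) (start I) t) → VisitsAll p →
               ∃[ c ] CostOPT I c × c ≤ cost p
    costOPT≤ p all with least (λ c → coveringWalk? {G} positive c [] (start I) c ≤-refl)
                              (cost p) (_ , p , (λ x → inj₂ (all x)) , refl)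
    ... | c , (t , q , covers , c≡) , c≤ , min =
      c , ((t , q , (λ x → Sum.fromInj₂ (λ ()) (covers x)) , c≡)
          , λ {t′} r all′ → min (cost r) (t′ , r , (λ x → inj₂ (all′ x)) , refl)) , c≤

  -- Covering two distinct vertices takes an arc. This makes the denominator of the ratio nonzero.
  costOPT-positive : ∀ {c u v} → u ≢ v → CostOPT I c → 1 ≤ c
  costOPT-positive {u = u} {v} u≢v ((_ , ε , all , _) , _) with all u | all v
  ... | here refl | here refl = contradiction refl u≢v
  costOPT-positive u≢v ((_ , (w , eq) ◅ p , _ , refl) , _) = ≤-trans (positive eq) (m≤m+n w _)

-- Rounds of the greedy algorithm

module _ {G : Graph} (I : Instance G) (visited : List (Vertex G)) where

  open DecMembership (Graph._≟_ G) using (_∈?_)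

  Known : Arcs (Vertex G)
  Known = revealed I visited

  known-source : ∀ {u v} → Arc Known u v → u ∈ visited
  known-source {u} a with u ∈? visited
  ... | yes u∈ = u∈
  known-source (_ , ()) | no _

  known⁺ : ∀ {u v w} → u ∈ visited → arc I u v ≡ just w → Known u v ≡ just w
  known⁺ {u} u∈ eq with u ∈? visited
  ... | yes _ = eq
  ... | no u∉ = contradiction u∈ u∉

  known⁻ : ∀ {u v w} → Known u v ≡ just w → arc I u v ≡ just w
  known⁻ {u} eq with u ∈? visited
  ... | yes _ = eq
  known⁻ () | no _

  cost-known : ∀ {u t} (q : Walk Known u t) → cost (Star.map (revealed⇒arc I visited) q) ≡ cost q
  cost-known ε = refl
  cost-known (_◅_ {i = u} a q) with u ∈? visited
  ... | yes _ = cong (proj₁ a +_) (cost-known q)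
  cost-known ((_ , ()) ◅ _) | no _

  -- All vertices of a known walk but its last are sources of known arcs, hence visited before. A
  -- round therefore adds at most its target to the visited vertices.
  trail-known : ∀ {u t x} (q : Walk Known u t) →
                x ∈ trail (Star.map (revealed⇒arc I visited) q) → x ∈ visited ⊎ x ≡ t
  trail-known ε       (here eq)  = inj₂ eq
  trail-known (a ◅ q) (here refl) = inj₁ (known-source a)
  trail-known (a ◅ q) (there x∈) = trail-known q x∈

  -- Up to its first arc into an unvisited vertex, a walk has visited sources only, so this initial
  -- part is known to the agent.
  first-unvisited : ∀ {u t} → Walk (arc I) u t → u ∈ visited → t ∉ visited →
                    ∃[ t′ ] Walk Known u t′ × t′ ∉ visited
  first-unvisited ε u∈ t∉ = contradiction u∈ t∉
  first-unvisited (_◅_ {j = v} (w , eq) r) u∈ t∉ with v ∈? visited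
  ... | no v∉ = v , (w , known⁺ u∈ eq) ◅ ε , v∉
  ... | yes v∈ with first-unvisited r v∈ t∉
  ...   | t′ , q , t′∉ = t′ , (w , known⁺ u∈ eq) ◅ q , t′∉

  -- The final arc is known, so its source is visited: the target of an exploring move is an
  -- out-neighbour of the visited set.
  last-arc : ∀ {u t} → Walk Known u t → u ∈ visited → t ∉ visited →
             ∃[ v ] v ∈ visited × Arc (arc I) v t
  last-arc ε u∈ t∉ = contradiction u∈ t∉
  last-arc ((w , eq) ◅ ε) u∈ t∉ = _ , u∈ , w , known⁻ eq
  last-arc (_ ◅ (a ◅ q)) u∈ t∉ = last-arc (a ◅ q) (known-source a) t∉

  -- The inequalities for single arcs telescope along the walk. Known arcs start in visited
  -- vertices, so unexplored shortcuts need not respect the potential.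
  potential-bound : (φ : Vertex G → ℕ) →
                    (∀ {u v w} → u ∈ visited → arc I u v ≡ just w → φ v ≤ w + φ u) →
                    ∀ {u t} (q : Walk Known u t) → φ t ≤ cost q + φ u
  potential-bound φ step ε = ≤-refl
  potential-bound φ step {u} {t} (_◅_ {j = v} (w , eq) q) = begin
    φ t                 ≤⟨ potential-bound φ step q ⟩
    cost q + φ v        ≤⟨ +-monoʳ-≤ (cost q) (step (known-source (w , eq)) (known⁻ eq)) ⟩
    cost q + (w + φ u)  ≡⟨ sym (+-assoc (cost q) w (φ u)) ⟩
    cost q + w + φ u    ≡⟨ cong (_+ φ u) (+-comm (cost q) w) ⟩
    w + cost q + φ u    ∎
    where open ≤-Reasoning

module _ {G : Graph} (gr : Greedy) (I : Instance G) where

  record Advance {u} (p : Walk (arc I) (start I) u) (t : Vertex G) (gap : ℕ) : Set where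
    constructor advanced
    field
      walk    : Walk (arc I) (start I) t
      greedy  : GreedyWalk gr I walk
      new     : ∀ {x} → x ∈ trail walk → x ∈ trail p ⊎ x ≡ t
      old     : trail p ⊆ trail walk
      cost≥   : gap + cost p ≤ cost walk

  module _ {u} {p : Walk (arc I) (start I) u} (greedy : GreedyWalk gr I p) where

    -- The tie-breaking rule is arbitrary, so target and cost bound are asked of every cheapest
    -- exploring move; the one chosen by `gr` is among them.
    advance : ∀ {t gap} → ∃ (Exploring (observe I p)) →
              (∀ M → CheapestExploring (observe I p) M → proj₁ M ≡ t × gap ≤ cost (proj₂ M)) →
              Advance p t gap
    advance {t} {gap} exploring determined
      with determined (Greedy.move gr G (observe I p)) (Greedy.cheapest gr (observe I p) exploring)
    ... | t≡ , gap≤ = subst (λ t → Advance p t gap) t≡ (advanced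
      (extend gr I p M)
      (round greedy (proj₁ (Greedy.cheapest gr (observe I p) exploring)))
      new
      (∈-trail-◅◅⁺ˡ p (Star.map (revealed⇒arc I (trail p)) (proj₂ M)))
      bound)
      where
      M = Greedy.move gr G (observe I p)
      q = Star.map (revealed⇒arc I (trail p)) (proj₂ M)
      new : ∀ {x} → x ∈ trail (p ◅◅ q) → x ∈ trail p ⊎ x ≡ proj₁ M
      new x∈ with ∈-trail-◅◅⁻ p q x∈
      ... | inj₁ x∈p = inj₁ x∈p
      ... | inj₂ x∈q = trail-known I (trail p) (proj₂ M) x∈q
      bound : gap + cost p ≤ cost (p ◅◅ q)
      bound = begin
        gap + cost p             ≤⟨ +-monoˡ-≤ (cost p) gap≤ ⟩
        cost (proj₂ M) + cost p  ≡⟨ cong (_+ cost p) (sym (cost-known I (trail p) (proj₂ M))) ⟩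
        cost q + cost p          ≡⟨ +-comm (cost q) (cost p) ⟩
        cost p + cost q          ≡⟨ sym (cost-◅◅ p q) ⟩
        cost (p ◅◅ q)            ∎
        where open ≤-Reasoning

    abstract

      -- Every exploring move ends with an arc leaving the visited set, and all such arcs lead to
      -- `t`. The walk `r` may contain unknown arcs; it only certifies that an exploring move
      -- exists.
      advance-forced : ∀ {t gap} → Walk (arc I) u t → t ∉ trail p →
                       (∀ {v x} → v ∈ trail p → x ∉ trail p → Arc (arc I) v x → x ≡ t) →
                       ((q : Walk (Known I (trail p)) u t) → gap ≤ cost q) →
                       Advance p t gap
      advance-forced {t} {gap} r t∉ forced gap≤ = advance exploring determined
        where
        exploring : ∃ (Exploring (observe I p))
        exploring with first-unvisited I (trail p) r (end∈trail p) t∉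
        ... | t′ , q , t′∉ = (t′ , q) , t′∉
        determined : ∀ M → CheapestExploring (observe I p) M → proj₁ M ≡ t × gap ≤ cost (proj₂ M)
        determined (t′ , q) (t′∉ , _) with last-arc I (trail p) q (end∈trail p) t′∉
        ... | v , v∈ , a with forced v∈ t′∉ a
        ...   | refl = refl , gap≤ q

      -- The direct arc to `t` is a competitor, so a cheapest move costs at most 1. As weights are
      -- positive, it is a single arc of weight 1, and uniqueness fixes its target.
      advance-cheap : ∀ {t} → Positive (arc I) → arc I u t ≡ just 1 → t ∉ trail p →
                      (∀ {x} → x ∉ trail p → arc I u x ≡ just 1 → x ≡ t) →
                      Advance p t 0
      advance-cheap {t} positive eq t∉ unique = advance (direct , t∉) determined
        where
        direct : Move (observe I p)
        direct = t , (1 , known⁺ I (trail p) (end∈trail p) eq) ◅ ε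
        single : ∀ {x} (q : Walk (Known I (trail p)) u x) → x ∉ trail p → cost q ≤ 1 →
                 arc I u x ≡ just 1
        single ε x∉ _ = contradiction (end∈trail p) x∉
        single ((w , e) ◅ ε) _ w≤ with ≤-antisym (subst (_≤ 1) (+-identityʳ w) w≤) (positive (known⁻ I (trail p) e))
        ... | refl = known⁻ I (trail p) e
        single ((w , e) ◅ ((w′ , e′) ◅ q)) _ w+≤ =
          contradiction (≤-trans (+-mono-≤ (positive (known⁻ I (trail p) e))
                                           (≤-trans (positive (known⁻ I (trail p) e′)) (m≤m+n w′ (cost q)))) w+≤)
                        λ { (s≤s ()) }
        determined : ∀ M → CheapestExploring (observe I p) M → proj₁ M ≡ t × 0 ≤ cost (proj₂ M)
        determined (x , q) (x∉ , min) = unique x∉ (single q x∉ (min direct t∉)) , z≤n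

-- Stacks of ladders

-- The rows of a ladder are `back`, with arcs towards index 0, and below it
-- `forth`, with arcs away from index 0.
data Side : Set where
  back forth : Side

record Place : Set where
  constructor ⟨_,_,_⟩
  field
    ladder : ℕ
    side   : Side
    index  : ℕ

open Place

-- The side on which column x of a ladder is completed: `back`, except that
-- column 0 is entered there.
home : ℕ → Side
home zero    = forth
home (suc _) = back

module _ (k N : ℕ) where

  -- The arcs into the preceding ladder need no exact description: they lead
  -- to explored places only.
  data Link : Place → ℕ → Place → Set where
    turn   : ∀ {l}     → Link ⟨ l , back , 0 ⟩ 1 ⟨ l , forth , 0 ⟩
    rung   : ∀ {l x}   → Link ⟨ l , forth , suc x ⟩ 1 ⟨ l , back , suc x ⟩
    ahead  : ∀ {l x}   → x < N → Link ⟨ l , forth , x ⟩ k ⟨ l , forth , suc x ⟩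
    behind : ∀ {l x}   → Link ⟨ l , back , suc x ⟩ 1 ⟨ l , back , x ⟩
    exit   : ∀ {l x}   → x ≡ N → Link ⟨ l , forth , x ⟩ k ⟨ suc l , back , 0 ⟩
    return : ∀ {l x y} → Link ⟨ suc l , back , suc x ⟩ 1 ⟨ l , forth , y ⟩

  Linked : Place → Place → Set
  Linked c d = ∃[ w ] Link c w d

  link-asym : ∀ {c d w w′} → Link c w d → ¬ Link d w′ c
  link-asym turn ()
  link-asym rung ()
  link-asym (ahead _) ()
  link-asym behind ()
  link-asym (exit _) ()
  link-asym return ()

  link-weight : ∀ {c d w w′} → Link c w d → Link c w′ d → w ≡ w′
  link-weight turn turn = refl
  link-weight rung rung = refl
  link-weight (ahead _) (ahead _) = refl
  link-weight behind behind = refl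
  link-weight (exit _) (exit _) = refl
  link-weight return return = refl

  weight-1-or-k : ∀ {c d w} → Link c w d → w ≡ 1 ⊎ w ≡ k
  weight-1-or-k turn = inj₁ refl
  weight-1-or-k rung = inj₁ refl
  weight-1-or-k (ahead _) = inj₂ refl
  weight-1-or-k behind = inj₁ refl
  weight-1-or-k (exit _) = inj₂ refl
  weight-1-or-k return = inj₁ refl

  -- The set of places that the greedy run has visited on completing column `x` of ladder `l`.
  Explored : ℕ → ℕ → Place → Set
  Explored l x c = ladder c < l ⊎ (ladder c ≡ l × index c ≤ x)

  -- `turn` and `rung` stay in their column, `behind` lowers the index and `return` the ladder. Only
  -- `ahead` and `exit` move on, which leaves a single way out of the explored set: from index `x`
  -- of the forth row.
  explored-link : ∀ {l x c d w} → x ≤ N → Link c w d → Explored l x c →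
                  Explored l x d
                  ⊎ (x < N × d ≡ ⟨ l , forth , suc x ⟩)
                  ⊎ (x ≡ N × d ≡ ⟨ suc l , back , 0 ⟩)
  explored-link x≤N turn done = inj₁ done
  explored-link x≤N rung done = inj₁ done
  explored-link x≤N (ahead _) (inj₁ l<) = inj₁ (inj₁ l<)
  explored-link x≤N (ahead y<N) (inj₂ (refl , y≤x)) with m≤n⇒m<n∨m≡n y≤x
  ... | inj₁ y<x = inj₁ (inj₂ (refl , y<x))
  ... | inj₂ refl = inj₂ (inj₁ (y<N , refl))
  explored-link x≤N behind (inj₁ l<) = inj₁ (inj₁ l<)
  explored-link x≤N behind (inj₂ (eq , y<x)) = inj₁ (inj₂ (eq , <⇒≤ y<x))
  explored-link x≤N (exit _) (inj₁ l<) with m≤n⇒m<n∨m≡n l<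
  ... | inj₁ sl< = inj₁ (inj₁ sl<)
  ... | inj₂ eq = inj₁ (inj₂ (eq , z≤n))
  explored-link x≤N (exit refl) (inj₂ (refl , N≤x)) = inj₂ (inj₂ (≤-antisym x≤N N≤x , refl))
  explored-link x≤N return (inj₁ l<) = inj₁ (inj₁ (<⇒≤ l<))
  explored-link x≤N return (inj₂ (refl , _)) = inj₁ (inj₁ ≤-refl)

  -- Next l x l′ s x′: after column x of ladder l, column x′ of ladder l′ is
  -- entered, on side s.
  data Next (l x : ℕ) : ℕ → Side → ℕ → Set where
    along  : x < N → Next l x l forth (suc x)
    across : x ≡ N → Next l x (suc l) back 0

  next-forced : ∀ {l x l′ s x′ c d w} → Next l x l′ s x′ → x ≤ N → Link c w d →
                Explored l x c → ¬ Explored l x d → d ≡ ⟨ l′ , s , x′ ⟩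
  next-forced next x≤N lk done undone with explored-link x≤N lk done
  next-forced next         x≤N lk done undone | inj₁ done′ = contradiction done′ undone
  next-forced (along _)    x≤N lk done undone | inj₂ (inj₁ (_ , eq)) = eq
  next-forced (along x<N)  x≤N lk done undone | inj₂ (inj₂ (x≡N , _)) = contradiction x≡N (<⇒≢ x<N)
  next-forced (across x≡N) x≤N lk done undone | inj₂ (inj₁ (x<N , _)) = contradiction x≡N (<⇒≢ x<N)
  next-forced (across _)   x≤N lk done undone | inj₂ (inj₂ (_ , eq)) = eq

  -- As `k` is at least 2, arcs of weight `k` cannot pass for arcs of weight 1. What is left on the
  -- entry side is the rung, or `turn` in column 0.
  next-cheap : ∀ {l x l′ s x′ d} → 2 ≤ k → Next l x l′ s x′ → Link ⟨ l′ , s , x′ ⟩ 1 d →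
               d ≡ ⟨ l′ , home x′ , x′ ⟩
  next-cheap 2≤k (along _)  rung      = refl
  next-cheap (s≤s ()) (along _) (ahead _)
  next-cheap (s≤s ()) (along _) (exit _)
  next-cheap 2≤k (across _) turn      = refl

  next-side : ∀ {l x l′ s x′} r → Next l x l′ s x′ → r ≡ s ⊎ r ≡ home x′
  next-side back  (along _)  = inj₂ refl
  next-side forth (along _)  = inj₁ refl
  next-side back  (across _) = inj₁ refl
  next-side forth (across _) = inj₂ refl

  next≢home : ∀ {l x l′ s x′} → Next l x l′ s x′ → s ≢ home x′
  next≢home (along _)  ()
  next≢home (across _) ()

  next-unexplored : ∀ {l x l′ s x′ r} → Next l x l′ s x′ → ¬ Explored l x ⟨ l′ , r , x′ ⟩
  next-unexplored (along _)  (inj₁ l<l)       = <-irrefl refl l<l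
  next-unexplored (along _)  (inj₂ (_ , x<x)) = <-irrefl refl x<x
  next-unexplored (across _) (inj₁ l<)        = <-asym l< ≤-refl
  next-unexplored (across _) (inj₂ (eq , _))  = 1+n≢n eq

  explored-next⁺ : ∀ {l x l′ s x′ c} → Next l x l′ s x′ → Explored l x c → Explored l′ x′ c
  explored-next⁺ (along _)  (inj₁ l<)         = inj₁ l<
  explored-next⁺ (along _)  (inj₂ (eq , ≤x))  = inj₂ (eq , m≤n⇒m≤1+n ≤x)
  explored-next⁺ (across _) (inj₁ l<)         = inj₁ (m≤n⇒m≤1+n l<)
  explored-next⁺ (across _) (inj₂ (refl , _)) = inj₁ ≤-refl

  explored-next⁻ : ∀ {l x l′ s x′ c} → Next l x l′ s x′ → index c ≤ N → Explored l′ x′ c →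
                   Explored l x c ⊎ (ladder c ≡ l′ × index c ≡ x′)
  explored-next⁻ (along _) _ (inj₁ l<) = inj₁ (inj₁ l<)
  explored-next⁻ (along _) _ (inj₂ (eq , ≤sx)) with m≤n⇒m<n∨m≡n ≤sx
  ... | inj₁ (s≤s ≤x) = inj₁ (inj₂ (eq , ≤x))
  ... | inj₂ ≡sx      = inj₂ (eq , ≡sx)
  explored-next⁻ (across refl) ≤N (inj₁ (s≤s l≤)) with m≤n⇒m<n∨m≡n l≤
  ... | inj₁ l< = inj₁ (inj₁ l<)
  ... | inj₂ eq = inj₁ (inj₂ (eq , ≤N))
  explored-next⁻ (across _) _ (inj₂ (eq , ≤0)) = inj₂ (eq , n≤0⇒n≡0 ≤0)

  -- Along an explored walk this potential increases only on the forth row of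
  -- ladder l, by 1 on the way in and by 2 per arc of weight k ≥ 2.
  potential : ℕ → Place → ℕ
  potential l ⟨ l′ , back  , x ⟩ = 0
  potential l ⟨ l′ , forth , x ⟩ with l′ ≟ l
  ... | yes _ = suc (2 * x)
  ... | no _  = 0

  potential-forth : ∀ l x → potential l ⟨ l , forth , x ⟩ ≡ suc (2 * x)
  potential-forth l x with l ≟ l
  ... | yes _  = refl
  ... | no l≢l = contradiction refl l≢l

  -- The delicate arc is `return`, which may enter the forth row of ladder `l` at any index. It
  -- would have to start in ladder `suc l`, where nothing is explored yet.
  potential-link : ∀ {l x c d w} → 2 ≤ k → Link c w d → Explored l x c →
                   potential l d ≤ w + potential l c
  potential-link {l} 2≤k (turn {l′}) done with l′ ≟ l
  ... | yes _ = ≤-refl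
  ... | no _  = z≤n
  potential-link 2≤k rung done = z≤n
  potential-link {l} 2≤k (ahead {l′} {x} _) done with l′ ≟ l
  ... | yes _ = ≤-trans (≤-reflexive (cong suc (*-suc 2 x)))
                        (≤-trans (≤-reflexive (sym (+-suc 2 (2 * x)))) (+-monoˡ-≤ (suc (2 * x)) 2≤k))
  ... | no _  = z≤n
  potential-link 2≤k behind done = z≤n
  potential-link 2≤k (exit _) done = z≤n
  potential-link {l} 2≤k (return {l′}) done with l′ ≟ l
  ... | no _  = z≤n
  potential-link 2≤k return (inj₁ l<) | yes refl = contradiction l< (<-asym ≤-refl)
  potential-link 2≤k return (inj₂ (eq , _)) | yes refl = contradiction eq 1+n≢n

-- Places of the grid vertices: odd-numbered ladders are mirrored.

below : ℕ × Side → ℕ × Side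
below (l , back)  = l , forth
below (l , forth) = suc l , back

-- Recursion on the row, instead of division by 2, makes the step to the next row an application of
-- `below`.
ladderSide : ℕ → ℕ × Side
ladderSide zero    = 0 , back
ladderSide (suc i) = below (ladderSide i)

row : ℕ × Side → ℕ
row (l , back)  = l * 2
row (l , forth) = suc (l * 2)

row-ladderSide : ∀ i → row (ladderSide i) ≡ i
row-ladderSide zero    = refl
row-ladderSide (suc i) = trans (row-below (ladderSide i)) (cong suc (row-ladderSide i))
  where
  row-below : ∀ r → row (below r) ≡ suc (row r)
  row-below (_ , back)  = refl
  row-below (_ , forth) = refl

ladderSide-row : ∀ r → ladderSide (row r) ≡ r
ladderSide-row (l , back) = even l
  where
  even : ∀ l → ladderSide (l * 2) ≡ (l , back)
  even zero    = refl
  even (suc l) = cong (λ r → below (below r)) (even l)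
ladderSide-row (l , forth) = cong below (ladderSide-row (l , back))

mirrored : ℕ → Bool
mirrored zero    = false
mirrored (suc l) = not (mirrored l)

module _ (N : ℕ) where

  reflect : Bool → ℕ → ℕ
  reflect true  x = N ∸ x
  reflect false x = x

  reflect≤ : ∀ b {x} → x ≤ N → reflect b x ≤ N
  reflect≤ true  {x} _ = m∸n≤m N x
  reflect≤ false x≤N   = x≤N

  reflect-involutive : ∀ b {x} → x ≤ N → reflect b (reflect b x) ≡ x
  reflect-involutive true  x≤N = m∸[m∸n]≡n x≤N
  reflect-involutive false _   = refl

  reflect-not : ∀ b {x} → x ≤ N → reflect (not b) x ≡ N ∸ reflect b x
  reflect-not true  x≤N = sym (m∸[m∸n]≡n x≤N)
  reflect-not false _   = refl

  reflect-suc : ∀ b {x} → x < N →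
                reflect b (suc x) ≡ suc (reflect b x) ⊎ reflect b x ≡ suc (reflect b (suc x))
  reflect-suc true  x<N = inj₂ (+-∸-assoc 1 x<N)
  reflect-suc false _   = inj₁ refl

  -- Mirroring puts the last index of a ladder and index 0 of the next one in the same grid column,
  -- so that the exit is an edge of the grid.
  reflect-ends : ∀ b → reflect b N ≡ reflect (not b) 0
  reflect-ends true  = n∸n≡0 N
  reflect-ends false = refl

  placeAt : ℕ × Side → ℕ → Place
  placeAt (l , s) c = ⟨ l , s , reflect (mirrored l) c ⟩

  placeAt-injective : ∀ r r′ {c c′} → c ≤ N → c′ ≤ N → placeAt r c ≡ placeAt r′ c′ →
                      r ≡ r′ × c ≡ c′
  placeAt-injective (l , s) (l′ , s′) {c} {c′} c≤ c′≤ eq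
    with cong ladder eq | cong side eq
  ... | refl | refl = refl ,
    trans (sym (reflect-involutive (mirrored l) c≤))
          (trans (cong (λ d → reflect (mirrored l) (index d)) eq) (reflect-involutive (mirrored l) c′≤))

  module _ (k : ℕ) where

    -- A vertical edge is a rung or joins two ladders. In the second case its lower end has index
    -- `N` minus that of its upper end, which is 0 exactly at the exit; every other such edge leads
    -- up.
    link-below : ∀ r {c} → c ≤ N →
                 Linked k N (placeAt r c) (placeAt (below r) c)
                 ⊎ Linked k N (placeAt (below r) c) (placeAt r c)
    link-below (l , back) {c} c≤ with reflect (mirrored l) c
    ... | zero  = inj₁ (_ , turn)
    ... | suc _ = inj₂ (_ , rung)
    link-below (l , forth) {c} c≤
      rewrite reflect-not (mirrored l) c≤
      with N ∸ reflect (mirrored l) c in eq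
    ... | zero  = inj₁ (_ , exit (≤-antisym (reflect≤ (mirrored l) c≤) (m∸n≡0⇒m≤n eq)))
    ... | suc _ = inj₂ (_ , return)

    link-beside : ∀ r {c} → c < N →
                  Linked k N (placeAt r c) (placeAt r (suc c))
                  ⊎ Linked k N (placeAt r (suc c)) (placeAt r c)
    link-beside (l , s) {c} c< with reflect-suc (mirrored l) c< | reflect≤ (mirrored l) (<⇒≤ c<) | reflect≤ (mirrored l) c<
    link-beside (l , back)  c< | inj₁ eq | _ | _ rewrite eq = inj₂ (_ , behind)
    link-beside (l , back)  c< | inj₂ eq | _ | _ rewrite eq = inj₁ (_ , behind)
    link-beside (l , forth) c< | inj₁ eq | _ | ≤N rewrite eq = inj₁ (_ , ahead ≤N)
    link-beside (l , forth) c< | inj₂ eq | ≤N | _ rewrite eq = inj₂ (_ , ahead ≤N)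

-- The last ladder is L, and the last index is `suc M`, so that there are at
-- least two columns.
module Stack (L k M : ℕ) (1≤k : 1 ≤ k) where

  m : ℕ
  m = suc L

  N : ℕ
  N = suc M

  G : Graph
  G = grid (m * 2) (suc N)

  open Graph G using (_~_; _~?_)

  V : Set
  V = Fin (m * 2) × Fin (suc N)

  -- Grid vertices as places, and the arcs between them

  abstract

    place : V → Place
    place (i , c) = placeAt N (ladderSide (toℕ i)) (toℕ c)

    row< : ∀ {l} s → l < m → row (l , s) < m * 2
    row< {l} back l<m  = *-monoˡ-< 2 l<m
    row< {l} forth l<m = *-monoˡ-≤ 2 l<m

    -- The bounds are irrelevant arguments, so that vertices given with different proofs of them
    -- agree definitionally and walks compose without transport.
    at : ∀ l (s : Side) x → .(l < m) → .(x ≤ N) → V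
    at l s x l<m x≤N =
      fromℕ< {row (l , s)} (row< s l<m) , fromℕ< {reflect N (mirrored l) x} (s≤s (reflect≤ N (mirrored l) x≤N))

    place-at : ∀ l s x (l<m : l < m) (x≤N : x ≤ N) → place (at l s x l<m x≤N) ≡ ⟨ l , s , x ⟩
    place-at l s x l<m x≤N
      rewrite Fin.toℕ-fromℕ< (row< s l<m) | Fin.toℕ-fromℕ< (s≤s (reflect≤ N (mirrored l) x≤N))
            | ladderSide-row (l , s) | reflect-involutive N (mirrored l) x≤N = refl

    column≤ : (c : Fin (suc N)) → toℕ c ≤ N
    column≤ c = Fin.toℕ≤pred[n] c

    place-injective : ∀ {u v} → place u ≡ place v → u ≡ v
    place-injective {i , c} {j , d} eq
      with placeAt-injective N (ladderSide (toℕ i)) (ladderSide (toℕ j)) (column≤ c) (column≤ d) eq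
    ... | r≡ , c≡ = cong₂ _,_
      (Fin.toℕ-injective (trans (sym (row-ladderSide (toℕ i))) (trans (cong row r≡) (row-ladderSide (toℕ j)))))
      (Fin.toℕ-injective c≡)

    ladder<m : ∀ v → ladder (place v) < m
    ladder<m (i , _) = *-cancelʳ-< 2 _ _
      (≤-<-trans (≤-trans (row≥ (ladderSide (toℕ i))) (≤-reflexive (row-ladderSide (toℕ i)))) (Fin.toℕ<n i))
      where
      row≥ : ∀ r → proj₁ r * 2 ≤ row r
      row≥ (_ , back)  = ≤-refl
      row≥ (_ , forth) = n≤1+n _

    index≤N : ∀ v → index (place v) ≤ N
    index≤N (i , c) = reflect≤ N (mirrored (proj₁ (ladderSide (toℕ i)))) (column≤ c)

    link-step : ∀ {u v} → GridStep u v →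
                Linked k N (place u) (place v) ⊎ Linked k N (place v) (place u)
    link-step {i , c} (inj₁ (eq , refl)) rewrite sym eq = link-below N k (ladderSide (toℕ i)) (column≤ c)
    link-step {i , c} {_ , d} (inj₂ (refl , eq)) with column≤ d
    ... | d≤ rewrite sym eq = link-beside N k (ladderSide (toℕ i)) d≤

    link : ∀ {u v} → u ~ v → Linked k N (place u) (place v) ⊎ Linked k N (place v) (place u)
    link (fwd s) = link-step s
    link (bwd s) = Sum.swap (link-step s)

    toℕ-fromℕ<-suc : ∀ {i j o} → suc i ≡ j → .(i<o : i < o) .(j<o : j < o) →
                     suc (toℕ (fromℕ< i<o)) ≡ toℕ (fromℕ< j<o)
    toℕ-fromℕ<-suc refl i<o j<o = trans (cong suc (Fin.toℕ-fromℕ< i<o)) (sym (Fin.toℕ-fromℕ< j<o))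

    rung~ : ∀ {l x} (l<m : l < m) (x≤N : x ≤ N) → at l back x l<m x≤N ~ at l forth x l<m x≤N
    rung~ l<m x≤N = fwd (inj₁ (toℕ-fromℕ<-suc refl (row< back l<m) (row< forth l<m) , refl))

    beside~ : ∀ {l x} (l<m : l < m) s (x<N : x < N) → at l s x l<m (<⇒≤ x<N) ~ at l s (suc x) l<m x<N
    beside~ {l} l<m s x<N with reflect-suc N (mirrored l) x<N
    ... | inj₁ eq = fwd (inj₂ (refl , toℕ-fromℕ<-suc (sym eq) _ _))
    ... | inj₂ eq = bwd (inj₂ (refl , toℕ-fromℕ<-suc (sym eq) _ _))

    exit~ : ∀ {l} (l<m : l < m) (sl<m : suc l < m) → at l forth N l<m ≤-refl ~ at (suc l) back 0 sl<m z≤n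
    exit~ {l} l<m sl<m = fwd (inj₁ ( toℕ-fromℕ<-suc refl (row< forth l<m) (row< back sl<m)
                           , Fin.fromℕ<-cong _ _ (reflect-ends N (mirrored l)) _ _ ))

    at-corner : at 0 back 0 (s≤s z≤n) z≤n ≡ corner (m * 2) (suc N)
    at-corner = refl

    -- Adjacency is tested separately since `Link` is coarser than the grid: `return` leaves the
    -- index of its target open.
    arcs : Arcs V
    arcs u v with u ~? v
    ... | no _ = nothing
    ... | yes u~v with link u~v
    ...   | inj₁ (w , _) = just w
    ...   | inj₂ _       = nothing

    arcs⁻ : ∀ {u v w} → arcs u v ≡ just w → u ~ v × Link k N (place u) w (place v)
    arcs⁻ {u} {v} eq with u ~? v
    ... | yes u~v with link u~v
    arcs⁻ refl | yes u~v | inj₁ (_ , l) = u~v , l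

    arcs⁺ : ∀ {u v w} → u ~ v → Link k N (place u) w (place v) → arcs u v ≡ just w
    arcs⁺ {u} {v} u~v l with u ~? v
    ... | no u≁v = contradiction u~v u≁v
    ... | yes u~v′ with link u~v′
    ...   | inj₁ (_ , l′) = cong just (link-weight k N l′ l)
    ...   | inj₂ (_ , l′) = contradiction l′ (link-asym k N l)

  arcs-oriented : ∀ {u v} → u ~ v → T (is-just (arcs u v) xor is-just (arcs v u))
  arcs-oriented {u} {v} u~v with link u~v
  ... | inj₁ (_ , l) rewrite arcs⁺ {u} {v} u~v l with arcs v u in eq
  ...   | nothing = _
  ...   | just _ = contradiction (proj₂ (arcs⁻ {v} {u} eq)) (link-asym k N l)
  arcs-oriented {u} {v} u~v | inj₂ (_ , l) rewrite arcs⁺ {v} {u} (Graph.~-sym G {u} {v} u~v) l with arcs u v in eq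
  ...   | nothing = _
  ...   | just _ = contradiction (proj₂ (arcs⁻ {u} {v} eq)) (link-asym k N l)

  arcs-positive : Positive arcs
  arcs-positive {u} {v} eq with weight-1-or-k k N (proj₂ (arcs⁻ {u} {v} eq))
  ... | inj₁ refl = ≤-refl
  ... | inj₂ refl = 1≤k

  at-place : ∀ v {s} → side (place v) ≡ s →
             v ≡ at (ladder (place v)) s (index (place v)) (ladder<m v) (index≤N v)
  at-place v refl = place-injective (sym (place-at _ _ _ (ladder<m v) (index≤N v)))

  arcs-at : ∀ {l s x l′ s′ x′ w} (l<m : l < m) (x≤N : x ≤ N) (l′<m : l′ < m) (x′≤N : x′ ≤ N) →
            at l s x l<m x≤N ~ at l′ s′ x′ l′<m x′≤N →
            Link k N ⟨ l , s , x ⟩ w ⟨ l′ , s′ , x′ ⟩ →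
            arcs (at l s x l<m x≤N) (at l′ s′ x′ l′<m x′≤N) ≡ just w
  arcs-at {l} {s} {x} {l′} {s′} {x′} {w} l<m x≤N l′<m x′≤N adj lk =
    arcs⁺ adj (subst (λ c → Link k N c w (place (at l′ s′ x′ l′<m x′≤N))) (sym (place-at l s x l<m x≤N))
              (subst (Link k N ⟨ l , s , x ⟩ w) (sym (place-at l′ s′ x′ l′<m x′≤N)) lk))

  -- A covering tour, bounding the optimum from above

  module _ {l : ℕ} (l<m : l < m) where

    arc-turn : arcs (at l back 0 l<m z≤n) (at l forth 0 l<m z≤n) ≡ just 1
    arc-turn = arcs-at l<m z≤n l<m z≤n (rung~ l<m z≤n) turn

    arc-rung : ∀ {x} (x<N : x < N) → arcs (at l forth (suc x) l<m x<N) (at l back (suc x) l<m x<N) ≡ just 1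
    arc-rung x<N = arcs-at l<m x<N l<m x<N (Graph.~-sym G (rung~ l<m x<N)) rung

    arc-ahead : ∀ {x} (x<N : x < N) → arcs (at l forth x l<m (<⇒≤ x<N)) (at l forth (suc x) l<m x<N) ≡ just k
    arc-ahead x<N = arcs-at l<m (<⇒≤ x<N) l<m x<N (beside~ l<m forth x<N) (ahead x<N)

    arc-behind : ∀ {x} (x<N : x < N) → arcs (at l back (suc x) l<m x<N) (at l back x l<m (<⇒≤ x<N)) ≡ just 1
    arc-behind x<N = arcs-at l<m x<N l<m (<⇒≤ x<N) (Graph.~-sym G (beside~ l<m back x<N)) behind

    arc-exit : (sl<m : suc l < m) → arcs (at l forth N l<m ≤-refl) (at (suc l) back 0 sl<m z≤n) ≡ just k
    arc-exit sl<m = arcs-at l<m ≤-refl sl<m z≤n (exit~ l<m sl<m) (exit refl)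

    forthWalk : ∀ {x} (x≤N : x ≤ N) → Walk arcs (at l forth 0 l<m z≤n) (at l forth x l<m x≤N)
    forthWalk {zero}  _   = ε
    forthWalk {suc x} x<N = forthWalk (<⇒≤ x<N) ◅◅ ((k , arc-ahead x<N) ◅ ε)

    cost-forthWalk : ∀ {x} (x≤N : x ≤ N) → cost (forthWalk x≤N) ≡ x * k
    cost-forthWalk {zero}  _   = refl
    cost-forthWalk {suc x} x<N = begin
      cost (forthWalk x<N)                  ≡⟨ cost-◅◅ (forthWalk (<⇒≤ x<N)) _ ⟩
      cost (forthWalk (<⇒≤ x<N)) + (k + 0)  ≡⟨ cong₂ _+_ (cost-forthWalk (<⇒≤ x<N)) (+-identityʳ k) ⟩
      x * k + k                             ≡⟨ +-comm (x * k) k ⟩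
      k + x * k                             ∎
      where open ≡-Reasoning

    ∈-forthWalk : ∀ {x y} (x≤N : x ≤ N) (y≤x : y ≤ x) →
                  at l forth y l<m (≤-trans y≤x x≤N) ∈ trail (forthWalk x≤N)
    ∈-forthWalk {zero}  _   z≤n = here refl
    ∈-forthWalk {suc x} x<N y≤ with m≤n⇒m<n∨m≡n y≤
    ... | inj₁ (s≤s y≤x) = ∈-trail-◅◅⁺ˡ (forthWalk (<⇒≤ x<N)) _ (∈-forthWalk (<⇒≤ x<N) y≤x)
    ... | inj₂ refl      = end∈trail (forthWalk x<N)

    backWalk : ∀ {x} (x≤N : x ≤ N) → Walk arcs (at l back x l<m x≤N) (at l back 0 l<m z≤n)
    backWalk {zero}  _   = ε
    backWalk {suc x} x<N = (1 , arc-behind x<N) ◅ backWalk (<⇒≤ x<N)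

    cost-backWalk : ∀ {x} (x≤N : x ≤ N) → cost (backWalk x≤N) ≡ x
    cost-backWalk {zero}  _   = refl
    cost-backWalk {suc x} x<N = cong suc (cost-backWalk (<⇒≤ x<N))

    ∈-backWalk : ∀ {x y} (x≤N : x ≤ N) (y≤x : y ≤ x) →
                 at l back y l<m (≤-trans y≤x x≤N) ∈ trail (backWalk x≤N)
    ∈-backWalk {zero}  _   z≤n = here refl
    ∈-backWalk {suc x} x<N y≤ with m≤n⇒m<n∨m≡n y≤
    ... | inj₁ (s≤s y≤x) = there (∈-backWalk (<⇒≤ x<N) y≤x)
    ... | inj₂ refl      = here refl

    -- The forth row is traversed twice, since the back row ends far from the exit.
    lap : Walk arcs (at l back 0 l<m z≤n) (at l forth N l<m ≤-refl)
    lap = (1 , arc-turn) ◅ forthWalk ≤-refl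
       ◅◅ ((1 , arc-rung ≤-refl) ◅ backWalk ≤-refl
       ◅◅ ((1 , arc-turn) ◅ forthWalk ≤-refl))

    ∈-lap : ∀ v → ladder (place v) ≡ l → v ∈ trail lap
    ∈-lap v refl with side (place v) in eq
    ... | forth = there (∈-trail-◅◅⁺ˡ (forthWalk ≤-refl) _
                  (subst (_∈ trail (forthWalk ≤-refl)) (sym (at-place v eq))
                         (∈-forthWalk ≤-refl (index≤N v))))
    ... | back = there (∈-trail-◅◅⁺ʳ (forthWalk ≤-refl) _ (there (∈-trail-◅◅⁺ˡ (backWalk ≤-refl) _
                  (subst (_∈ trail (backWalk ≤-refl)) (sym (at-place v eq))
                         (∈-backWalk ≤-refl (index≤N v))))))

    -- The summand `k` pays for the exit arc through which the ladder is entered, so that the bounds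
    -- for the ladders add up.
    cost-lap : k + cost lap ≤ 4 * k * suc N
    cost-lap = begin
      k + cost lap
        ≡⟨ cong (λ c → k + suc c) (cost-◅◅ (forthWalk ≤-refl) _) ⟩
      k + suc (cost (forthWalk ≤-refl) + suc (cost (backWalk ≤-refl ◅◅ ((1 , arc-turn) ◅ forthWalk ≤-refl))))
        ≡⟨ cong₂ (λ c d → k + suc (c + suc d)) (cost-forthWalk ≤-refl)
             (trans (cost-◅◅ (backWalk ≤-refl) _)
                    (cong₂ (λ c d → c + suc d) (cost-backWalk ≤-refl) (cost-forthWalk ≤-refl))) ⟩
      k + (1 + (N * k + (1 + (N + (1 + N * k)))))
        ≤⟨ +-monoʳ-≤ k (+-mono-≤ 1≤k (+-monoʳ-≤ (N * k) (+-mono-≤ 1≤k (+-mono-≤ N≤Nk (+-monoˡ-≤ (N * k) 1≤k))))) ⟩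
      k + (k + (N * k + (k + (N * k + (k + N * k)))))
        -- A fourth `N * k` is added to match the four summands `k` and give a multiple of `suc N`.
        ≤⟨ m≤n+m _ (N * k) ⟩
      N * k + (k + (k + (N * k + (k + (N * k + (k + N * k))))))
        ≡⟨ total N k ⟩
      4 * k * suc N ∎
      where
      open ≤-Reasoning
      N≤Nk : N ≤ N * k
      N≤Nk = ≤-trans (≤-reflexive (sym (*-identityʳ N))) (*-monoʳ-≤ N 1≤k)
      total : ∀ N k → N * k + (k + (k + (N * k + (k + (N * k + (k + N * k)))))) ≡ 4 * k * suc N
      total = solve-∀

  tour : ∀ {l} (l<m : l < m) → Walk arcs (at 0 back 0 (s≤s z≤n) z≤n) (at l forth N l<m ≤-refl)
  tour {zero}  l<m  = lap l<m
  tour {suc l} sl<m = tour (<⇒≤ sl<m) ◅◅ ((k , arc-exit (<⇒≤ sl<m) sl<m) ◅ lap sl<m)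

  ∈-tour : ∀ {l} (l<m : l < m) v → ladder (place v) ≤ l → v ∈ trail (tour l<m)
  ∈-tour {zero}  l<m v l≤ = ∈-lap l<m v (n≤0⇒n≡0 l≤)
  ∈-tour {suc l} sl<m v l≤ with m≤n⇒m<n∨m≡n l≤
  ... | inj₁ (s≤s l≤′) = ∈-trail-◅◅⁺ˡ (tour (<⇒≤ sl<m)) _ (∈-tour (<⇒≤ sl<m) v l≤′)
  ... | inj₂ eq        = ∈-trail-◅◅⁺ʳ (tour (<⇒≤ sl<m)) _ (there (∈-lap sl<m v eq))

  cost-tour : ∀ {l} (l<m : l < m) → cost (tour l<m) ≤ suc l * (4 * k * suc N)
  -- No arc leads into the first ladder; its `k` is slack.
  cost-tour {zero}  l<m  = ≤-trans (m≤n+m _ k) (≤-trans (cost-lap l<m) (m≤m+n _ 0))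
  cost-tour {suc l} sl<m = begin
    cost (tour sl<m)                                    ≡⟨ cost-◅◅ (tour (<⇒≤ sl<m)) _ ⟩
    cost (tour (<⇒≤ sl<m)) + (k + cost (lap sl<m))      ≤⟨ +-mono-≤ (cost-tour (<⇒≤ sl<m)) (cost-lap sl<m) ⟩
    suc l * (4 * k * suc N) + 4 * k * suc N             ≡⟨ +-comm (suc l * (4 * k * suc N)) _ ⟩
    4 * k * suc N + suc l * (4 * k * suc N)             ∎
    where open ≤-Reasoning

  tour-visitsAll : VisitsAll (tour {L} ≤-refl)
  tour-visitsAll v = ∈-tour ≤-refl v (s≤s⁻¹ (ladder<m v))

  stack : Instance G
  stack = record
    { start    = at 0 back 0 (s≤s z≤n) z≤n
    ; arc      = arcs
    ; arc⇒edge = λ { {u} {v} (_ , eq) → proj₁ (arcs⁻ {u} {v} eq) }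
    ; oriented = arcs-oriented
    ; solvable = _ , tour ≤-refl , tour-visitsAll
    }

  toStart : ∀ {l x} (l<m : l < m) (x≤N : x ≤ N) →
            Walk arcs (at l (home x) x l<m x≤N) (at l forth 0 l<m z≤n)
  toStart {x = zero}  _   _   = ε
  toStart {x = suc x} l<m x<N = backWalk l<m x<N ◅◅ ((1 , arc-turn l<m) ◅ ε)

  -- The run of the greedy algorithm

  module _ (gr : Greedy) (2≤k : 2 ≤ k) where

    -- The invariant of the run: the visited vertices are exactly the explored ones. In `cost≥` each
    -- finished ladder counts `N * N`, and `x * x` is a lower bound for 2 + 4 + ... + 2x, where 2j
    -- bounds the cost of reaching column j from the column before.
    record Stage (l x : ℕ) (l<m : l < m) (x≤N : x ≤ N) : Set where
      field
        walk      : Walk arcs (start stack) (at l (home x) x l<m x≤N)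
        greedy    : GreedyWalk gr stack walk
        explored  : ∀ {v} → v ∈ trail walk → Explored k N l x (place v)
        visited   : ∀ {v} → Explored k N l x (place v) → v ∈ trail walk
        cost≥     : l * (N * N) + x * x ≤ cost walk

    open Stage

    -- Two rounds complete a column. The first is forced to the entry side `s` at cost at least
    -- `gap`; in the second the arc of weight 1 draws the agent to `home x′`. Only the first is
    -- charged.
    nextStage : {l x : ℕ} {l<m : l < m} {x≤N : x ≤ N} {l′ : ℕ} {s : Side} {x′ : ℕ} {l′<m : l′ < m} {x′≤N : x′ ≤ N}
                (S : Stage l x l<m x≤N) → Next k N l x l′ s x′ → (gap : ℕ) →
                Walk arcs (at l (home x) x l<m x≤N) (at l′ s x′ l′<m x′≤N) →
                ((q : Walk (Known stack (trail (walk S))) (at l (home x) x l<m x≤N) (at l′ s x′ l′<m x′≤N)) →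
                   gap ≤ cost q) →
                arcs (at l′ s x′ l′<m x′≤N) (at l′ (home x′) x′ l′<m x′≤N) ≡ just 1 →
                l′ * (N * N) + x′ * x′ ≤ gap + (l * (N * N) + x * x) →
                Stage l′ x′ l′<m x′≤N
    nextStage {l} {x} {x≤N = x≤N} {l′} {s} {x′} {l′<m} {x′≤N} S next gap reach gap≤ arc≡1 bound = record
      { walk     = Advance.walk second
      ; greedy   = Advance.greedy second
      ; explored = explored′
      ; visited  = visited′
      ; cost≥    = ≤-trans bound (≤-trans (+-monoʳ-≤ gap (cost≥ S)) (≤-trans (Advance.cost≥ first) (Advance.cost≥ second)))
      }
      where
      e f : V
      e = at l′ s x′ l′<m x′≤N
      f = at l′ (home x′) x′ l′<m x′≤N
      place-e : place e ≡ ⟨ l′ , s , x′ ⟩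
      place-e = place-at l′ s x′ l′<m x′≤N
      place-f : place f ≡ ⟨ l′ , home x′ , x′ ⟩
      place-f = place-at l′ (home x′) x′ l′<m x′≤N
      first : Advance gr stack (walk S) e gap
      first = advance-forced gr stack (greedy S) reach
        (λ e∈ → next-unexplored k N {r = s} next (subst (Explored k N l x) place-e (explored S e∈)))
        (λ (v∈ : _ ∈ trail (walk S)) y∉ (_ , eq) → place-injective (trans
          (next-forced k N next x≤N (proj₂ (arcs⁻ eq)) (explored S v∈) (λ ex → y∉ (visited S ex)))
          (sym place-e)))
        gap≤
      f∉ : f ∉ trail (Advance.walk first)
      f∉ f∈ with Advance.new first f∈
      ... | inj₁ f∈′ = next-unexplored k N {r = home x′} next (subst (Explored k N l x) place-f (explored S f∈′))
      ... | inj₂ f≡e = next≢home k N next (cong side (trans (sym place-e) (trans (cong place (sym f≡e)) place-f)))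
      second : Advance gr stack (Advance.walk first) f 0
      second = advance-cheap gr stack (Advance.greedy first) arcs-positive arc≡1 f∉
        (λ {y} _ eq → place-injective (trans
          (next-cheap k N 2≤k next (subst (λ c → Link k N c 1 (place y)) place-e (proj₂ (arcs⁻ eq))))
          (sym place-f)))
      explored′ : ∀ {v} → v ∈ trail (Advance.walk second) → Explored k N l′ x′ (place v)
      explored′ {v} v∈ with Advance.new second v∈
      ... | inj₂ refl = subst (Explored k N l′ x′) (sym place-f) (inj₂ (refl , ≤-refl))
      ... | inj₁ v∈′ with Advance.new first v∈′
      ...   | inj₂ refl = subst (Explored k N l′ x′) (sym place-e) (inj₂ (refl , ≤-refl))
      ...   | inj₁ v∈″ = explored-next⁺ k N {c = place v} next (explored S v∈″)
      visited′ : ∀ {v} → Explored k N l′ x′ (place v) → v ∈ trail (Advance.walk second)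
      visited′ {v} ex with explored-next⁻ k N {c = place v} next (index≤N v) ex
      ... | inj₁ ex′ = Advance.old second (Advance.old first (visited S ex′))
      ... | inj₂ (refl , refl) with next-side k N (side (place v)) next
      ...   | inj₁ eq = subst (_∈ trail (Advance.walk second)) (sym (at-place v eq))
                              (Advance.old second (end∈trail (Advance.walk first)))
      ...   | inj₂ eq = subst (_∈ trail (Advance.walk second)) (sym (at-place v eq)) (end∈trail (Advance.walk second))

    potential-home : ∀ {l} x → potential k N l ⟨ l , home x , x ⟩ ≤ 1
    potential-home {l} zero = ≤-reflexive (potential-forth k N l 0)
    potential-home (suc _)  = z≤n

    -- The potential is `suc (2 * suc x)` at the target and at most 1 at `home x`, and on explored
    -- ground it rises no faster than the cost. This captures the detour through column 0.
    ahead-gap : ∀ {l x l<m x≤N} (S : Stage l x l<m x≤N) (x<N : x < N) →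
                (q : Walk (Known stack (trail (walk S))) (at l (home x) x l<m x≤N) (at l forth (suc x) l<m x<N)) →
                2 * suc x ≤ cost q
    ahead-gap {l} {x} {l<m} {x≤N} S x<N q = s≤s⁻¹ (begin
      suc (2 * suc x)                        ≡⟨ sym (potential-forth k N l (suc x)) ⟩
      φ ⟨ l , forth , suc x ⟩                ≡⟨ cong φ (sym (place-at l forth (suc x) l<m x<N)) ⟩
      φ (place (at l forth (suc x) l<m x<N)) ≤⟨ potential-bound stack (trail (walk S)) (λ v → φ (place v))
                                                  (λ v∈ eq → potential-link k N 2≤k (proj₂ (arcs⁻ eq)) (explored S v∈)) q ⟩
      cost q + φ (place (at l (home x) x l<m x≤N)) ≡⟨ cong (λ c → cost q + φ c) (place-at l (home x) x l<m x≤N) ⟩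
      cost q + φ ⟨ l , home x , x ⟩          ≤⟨ +-monoʳ-≤ (cost q) (potential-home x) ⟩
      cost q + 1                             ≡⟨ +-comm (cost q) 1 ⟩
      suc (cost q)                           ∎)
      where
      open ≤-Reasoning
      φ : Place → ℕ
      φ = potential k N l

    -- The first column takes one round only, since its entry side is the start vertex.
    firstStage : (0<m : 0 < m) → Stage 0 0 0<m z≤n
    firstStage 0<m = record
      { walk     = Advance.walk second
      ; greedy   = Advance.greedy second
      ; explored = explored′
      ; visited  = visited′
      ; cost≥    = z≤n
      }
      where
      e f : V
      e = at 0 back 0 (s≤s z≤n) z≤n
      f = at 0 forth 0 (s≤s z≤n) z≤n
      place-e : place e ≡ ⟨ 0 , back , 0 ⟩
      place-e = place-at 0 back 0 (s≤s z≤n) z≤n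
      place-f : place f ≡ ⟨ 0 , forth , 0 ⟩
      place-f = place-at 0 forth 0 (s≤s z≤n) z≤n
      f≢e : f ≢ e
      f≢e f≡e with trans (sym place-f) (trans (cong place f≡e) place-e)
      ... | ()
      second : Advance gr stack ε f 0
      second = advance-cheap gr stack GreedyWalk.begin arcs-positive (arc-turn (s≤s z≤n))
        (λ { (here eq) → f≢e eq })
        (λ {y} _ eq → place-injective (trans
          (from-corner (subst (λ c → Link k N c 1 (place y)) place-e (proj₂ (arcs⁻ eq))))
          (sym place-f)))
        where
        from-corner : ∀ {d} → Link k N ⟨ 0 , back , 0 ⟩ 1 d → d ≡ ⟨ 0 , forth , 0 ⟩
        from-corner turn = refl
      explored′ : ∀ {v} → v ∈ trail (Advance.walk second) → Explored k N 0 0 (place v)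
      explored′ v∈ with Advance.new second v∈
      ... | inj₂ refl        = subst (Explored k N 0 0) (sym place-f) (inj₂ (refl , ≤-refl))
      ... | inj₁ (here refl) = subst (Explored k N 0 0) (sym place-e) (inj₂ (refl , ≤-refl))
      visited′ : ∀ {v} → Explored k N 0 0 (place v) → v ∈ trail (Advance.walk second)
      visited′ {v} (inj₂ (l≡ , x≤)) with place v in eq
      visited′ {v} (inj₂ (refl , z≤n)) | ⟨ _ , back , _ ⟩ =
        subst (_∈ trail (Advance.walk second)) (place-injective (trans place-e (sym eq)))
              (Advance.old second (here refl))
      visited′ {v} (inj₂ (refl , z≤n)) | ⟨ _ , forth , _ ⟩ =
        subst (_∈ trail (Advance.walk second)) (place-injective (trans place-f (sym eq)))
              (end∈trail (Advance.walk second))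

    stage : ∀ l x (l<m : l < m) (x≤N : x ≤ N) → Stage l x l<m x≤N
    stage zero zero l<m z≤n = firstStage l<m
    stage (suc l) zero sl<m z≤n =
      -- Nothing is charged for the change of ladder: the `N * N` of the completed one is already in
      -- its last `x * x`.
      nextStage (stage l N (<⇒≤ sl<m) ≤-refl) (across refl) 0
        (toStart (<⇒≤ sl<m) ≤-refl ◅◅ (forthWalk (<⇒≤ sl<m) ≤-refl ◅◅ ((k , arc-exit (<⇒≤ sl<m) sl<m) ◅ ε)))
        (λ _ → z≤n)
        (arc-turn sl<m)
        (≤-reflexive (trans (+-identityʳ _) (+-comm (N * N) (l * (N * N)))))
    stage l (suc x) l<m x<N =
      nextStage S (along x<N) (2 * suc x)
        (toStart l<m (<⇒≤ x<N) ◅◅ forthWalk l<m x<N)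
        (ahead-gap S x<N)
        (arc-rung l<m x<N)
        -- The gap `2 * suc x` exceeds the difference of the consecutive squares by 1.
        (≤-trans (n≤1+n _) (≤-reflexive (square (l * (N * N)) x)))
      where
      S : Stage l x l<m (<⇒≤ x<N)
      S = stage l x l<m (<⇒≤ x<N)
      square : ∀ b x → suc (b + suc x * suc x) ≡ 2 * suc x + (b + x * x)
      square = solve-∀

    abstract

      greedy-cost : ∃[ c ] CostGR gr stack c × suc L * (N * N) ≤ c
      greedy-cost = cost (walk S) , (_ , walk S , greedy S , visitsAll , refl) , ≤-trans (≤-reflexive (+-comm (N * N) _)) (cost≥ S)
        where
        S : Stage L N ≤-refl ≤-refl
        S = stage L N ≤-refl ≤-refl
        visitsAll : VisitsAll (walk S)
        visitsAll v with m≤n⇒m<n∨m≡n (s≤s⁻¹ (ladder<m v))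
        ... | inj₁ l<L = visited S (inj₁ l<L)
        ... | inj₂ l≡L = visited S (inj₂ (l≡L , index≤N v))

  opt-cost : ∃[ c ] CostOPT stack c × c ≤ suc L * (4 * k * suc N) × 1 ≤ c
  opt-cost = estimate (costOPT≤ stack arcs-positive (tour ≤-refl) tour-visitsAll)
    where
    two : at 0 back 0 (s≤s z≤n) z≤n ≢ at 0 forth 0 (s≤s z≤n) z≤n
    two eq with trans (sym (place-at 0 back 0 (s≤s z≤n) z≤n)) (trans (cong place eq) (place-at 0 forth 0 (s≤s z≤n) z≤n))
    ... | ()
    estimate : ∃[ c ] CostOPT stack c × c ≤ cost (tour {L} ≤-refl) →
               ∃[ c ] CostOPT stack c × c ≤ suc L * (4 * k * suc N) × 1 ≤ c
    estimate (c , opt , c≤) =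
      c , opt , ≤-trans c≤ (cost-tour ≤-refl) , costOPT-positive stack arcs-positive two opt

  stack-weights : WeightsOneOr stack k
  stack-weights eq = weight-1-or-k k N (proj₂ (arcs⁻ eq))

-- The ratio, and the two families

ratio-≤ : ∀ n k c d → .{{_ : NonZero d}} → n * d ≤ 16 * suc k * c →
          ((ℤ.+ n) / 1 ÷ ((ℤ.+ (16 * suc k)) / 1)) ℚᵘ.≤ (ℤ.+ c) / d
ratio-≤ n k c d@(suc _) le = *≤* (begin
  (ℤ.+ n ℤ.* ℤ.+ 1) ℤ.* ℤ.+ d     ≡⟨ cong (ℤ._* ℤ.+ d) (ℤ.*-identityʳ (ℤ.+ n)) ⟩
  ℤ.+ n ℤ.* ℤ.+ d                 ≡⟨ sym (ℤ.pos-* n d) ⟩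
  ℤ.+ (n * d)                     ≤⟨ ℤ.+≤+ le ⟩
  ℤ.+ (16 * suc k * c)            ≡⟨ cong ℤ.+_ (*-comm (16 * suc k) c) ⟩
  ℤ.+ (c * (16 * suc k))          ≡⟨ cong (λ e → ℤ.+ (c * e)) (sym (*-identityˡ (16 * suc k))) ⟩
  ℤ.+ (c * (1 * (16 * suc k)))    ≡⟨ ℤ.pos-* c (1 * (16 * suc k)) ⟩
  ℤ.+ c ℤ.* ℤ.+ (1 * (16 * suc k)) ∎)
  where open ℤ.≤-Reasoning

-- Both bounds are proportional to the number of ladders, which cancels. The 16 is the 4 of the laps
-- times the 4 from replacing `n * n` by `(N + N) * (N + N)`.
stack-ratio : ∀ gr L k M → (1≤k : 1 ≤ suc k) → 2 ≤ suc k →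
              RatioAtLeast gr (Stack.stack L (suc k) M 1≤k) ((ℤ.+ (2 + M)) / 1 ÷ ((ℤ.+ (16 * suc k)) / 1))
stack-ratio gr L k M 1≤k 2≤k
  with Stack.greedy-cost L (suc k) M 1≤k gr 2≤k | Stack.opt-cost L (suc k) M 1≤k
... | c , isGR , c≥ | d , isOPT , d≤ , 1≤d =
  c , d , isGR , isOPT , >-nonZero 1≤d , ratio-≤ (2 + M) k c d {{>-nonZero 1≤d}} (begin
    n * d                                    ≤⟨ *-monoʳ-≤ n d≤ ⟩
    n * (suc L * (4 * suc k * n))            ≡⟨ left n (suc L) (suc k) ⟩
    4 * suc L * suc k * (n * n)              ≤⟨ *-monoʳ-≤ (4 * suc L * suc k) (*-mono-≤ n≤2N n≤2N) ⟩
    4 * suc L * suc k * ((N + N) * (N + N))  ≡⟨ right N (suc L) (suc k) ⟩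
    16 * suc k * (suc L * (N * N))           ≤⟨ *-monoʳ-≤ (16 * suc k) c≥ ⟩
    16 * suc k * c                           ∎)
  where
  open ≤-Reasoning
  N n : ℕ
  N = suc M
  n = suc N
  n≤2N : n ≤ N + N
  n≤2N = s≤s (m≤n+m N M)
  left : ∀ n m k → n * (m * (4 * k * n)) ≡ 4 * m * k * (n * n)
  left = solve-∀
  right : ∀ N m k → 4 * m * k * ((N + N) * (N + N)) ≡ 16 * k * (m * (N * N))
  right = solve-∀

mainTheorem4 : (k : ℕ) → 5 ≤ k → (gr : Greedy) →
    LinearLowerBound k gr (λ n → grid 2 n) (λ n → corner 2 n)
    × LinearLowerBound k gr (λ n → grid n n) (λ n → corner n n)
mainTheorem4 (suc k) 5≤k gr = ladders , squares
  where
  1≤k : 1 ≤ suc k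
  1≤k = s≤s z≤n
  2≤k : 2 ≤ suc k
  2≤k = ≤-trans (s≤s (s≤s z≤n)) 5≤k
  ladders : LinearLowerBound (suc k) gr (λ n → grid 2 n) (λ n → corner 2 n)
  -- A single ladder with last index `suc N` has `2 + N` columns.
  ladders = (ℤ.+ (16 * suc k)) / 1 , _ , λ N →
    2 + N , _ , m≤n+m N 2 , Stack.stack 0 (suc k) N 1≤k , Stack.at-corner 0 (suc k) N 1≤k ,
    Stack.stack-weights 0 (suc k) N 1≤k , stack-ratio gr 0 k N 1≤k 2≤k
  squares : LinearLowerBound (suc k) gr (λ n → grid n n) (λ n → corner n n)
  -- A stack of `suc N` ladders has `suc N * 2` rows; the last index `suc (N * 2)` gives as many
  -- columns.
  squares = (ℤ.+ (16 * suc k)) / 1 , _ , λ N →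
    suc N * 2 , _ , ≤-trans (m≤m*n N 2) (m≤n+m (N * 2) 2) ,
    Stack.stack N (suc k) (N * 2) 1≤k , Stack.at-corner N (suc k) (N * 2) 1≤k ,
    Stack.stack-weights N (suc k) (N * 2) 1≤k , stack-ratio gr N k (N * 2) 1≤k 2≤k
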